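{- 1. Every $K_{im}$-algebra (or $K_{im-\vee}$-algebra) $\mathcal{A}$ can be embedded into the complex algebra $Up(\mathcal{F}_{\mathcal{A}})$ of the canonical frame $\mathcal{F}_{\mathcal{A}}$ of $\mathcal{A}$. 2. Every sub-compatibility frame (or sub-compatibility identity frame) $\mathcal{F}$ can be embedded into the canonical frame $\mathcal{F}_{Up(\mathcal{F})}$ of the complex algebra $Up(\mathcal{F})$ of $\mathcal{F}$.
   Context: On a bounded distributive lattice $(A,1,0,\vee,\wedge)$, a unary operation $n$ is a preminimal negation if $a\leq b\Rightarrow nb\leq na$, $na\wedge nb\leq n(a\vee b)$ and $n0=1$; a minimal negation if moreover $a\leq nna$ and $a\wedge b\leq c\Rightarrow a\wedge nc\leq nb$; an intuitionistic negation if moreover $a\wedge na\leq b$ for all $a,b$. A $K_{im}$-algebra is $(A,1,0,\vee,\wedge,\neg,\sim)$ with $(A,1,0,\vee,\wedge)$ a bounded distributive lattice, $\neg$ an intuitionistic negation, $\sim$ a minimal negation, and $\neg\neg\sim1=\sim1$. A $K_{im-\vee}$-algebra is a $K_{im}$-algebra with $a\vee\sim a=1$ for all $a$. A compatibility frame is $(W,C,\leq)$ with $(W,\leq)$ a poset and $C$ a binary relation on $W$ such that $x'\leq x$, $y'\leq y$ and $xCy$ imply $x'Cy'$. A sub-compatibility frame is a compatibility frame such that (1) $C$ is symmetric; (2) $\forall x,y\,(xCy\Rightarrow\exists z(x\leq z\ \&\ y\leq z\ \&\ xCz))$; (3) for all $x$: if for every $y\geq x$ there is $z\geq y$ with no $z'$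 satisfying $zCz'$, then there is no $z''$ with $xCz''$. A sub-compatibility identity frame is a sub-compatibility frame in which $xCy$ implies $y\leq x$. The complex algebra of $\mathcal{F}=(W,C,\leq)$ is $Up(\mathcal{F})=(Up(W),W,\emptyset,\cup,\cap,\neg,\sim)$, where $Up(W)$ is the set of upsets of $W$, $\neg U=\{w:\forall v\in W\,(w\leq v\Rightarrow v\notin U)\}$ and $\sim U=\{w:\forall v\in W\,(wCv\Rightarrow v\notin U)\}$; for a sub-compatibility (identity) frame it is a $K_{im}$-algebra ($K_{im-\vee}$-algebra). The canonical frame of a $K_{im}$-algebra $\mathcal{A}$ is $\mathcal{F}_{\mathcal{A}}=(X_A,C,\subseteq)$, where $X_A$ is the set of prime filters of $\mathcal{A}$ and $PCQ$ iff for all $a\in A$, $\sim a\in P\Rightarrow a\notin Q$. An embedding of algebras is an order-preserving and order-reflecting map preserving all operations. An embedding of frames $(W,C,\leq)\to(W',C',\leq')$ is a map $f$ with $x\leq y\Leftrightarrow f(x)\leq'f(y)$ and $xCy\Leftrightarrow f(x)C'f(y)$ for all $x,y\in W$. -}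

module Defs where

open import Level using (Level; _⊔_) renaming (suc to lsuc)
open import Algebra.Core using (Op₁; Op₂)
open import Algebra.Definitions using (_DistributesOverˡ_)
open import Data.Product using (_×_; _,_; proj₁; proj₂; ∃; ∃-syntax; ∄-syntax)
open import Data.Sum using (_⊎_; inj₁; inj₂; [_,_])
open import Function.Base using (_∘_)
open import Function.Bundles using (_⇔_)
open import Relation.Binary.Bundles using (Poset)
open import Relation.Binary.Core using (Rel)
open import Relation.Binary.Lattice.Structures using (IsBoundedLattice)
open import Relation.Unary using (Pred; _∈_; _∉_; _⊆_; _≐_; _∪_; _∩_)
open import Relation.Unary.Polymorphic using (U; ∅)
open import Relation.Unary.Relation.Binary.Subset using (⊆-isPartialOrder)
import Relation.Binary.Construct.On as On

private
  variable
    c ℓ₁ ℓ₂ c′ ℓ₁′ ℓ₂′ : Level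

------------------------------------------------------------------------
-- Algebras

-- As in the standard library, equality is a setoid equality _≈_.

record BoundedDistributiveLattice c ℓ₁ ℓ₂ : Set (lsuc (c ⊔ ℓ₁ ⊔ ℓ₂)) where
  infix  4 _≈_ _≤_
  infixr 6 _∨_
  infixr 7 _∧_
  field
    Carrier          : Set c
    _≈_              : Rel Carrier ℓ₁
    _≤_              : Rel Carrier ℓ₂
    _∨_              : Op₂ Carrier
    _∧_              : Op₂ Carrier
    ⊤                : Carrier
    ⊥                : Carrier
    isBoundedLattice : IsBoundedLattice _≈_ _≤_ _∨_ _∧_ ⊤ ⊥
    ∧-distribˡ-∨     : _DistributesOverˡ_ _≈_ _∧_ _∨_

  open IsBoundedLattice isBoundedLattice public

module _ (L : BoundedDistributiveLattice c ℓ₁ ℓ₂) where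
  open BoundedDistributiveLattice L

  record IsPreminimalNegation (n : Op₁ Carrier) : Set (c ⊔ ℓ₁ ⊔ ℓ₂) where
    field
      antitone : ∀ {x y} → x ≤ y → n y ≤ n x
      ∧-∨      : ∀ x y → n x ∧ n y ≤ n (x ∨ y)
      n⊥≈⊤     : n ⊥ ≈ ⊤

  record IsMinimalNegation (n : Op₁ Carrier) : Set (c ⊔ ℓ₁ ⊔ ℓ₂) where
    field
      isPreminimalNegation : IsPreminimalNegation n
      double               : ∀ x → x ≤ n (n x)
      contrapose           : ∀ {x y z} → x ∧ y ≤ z → x ∧ n z ≤ n y

    open IsPreminimalNegation isPreminimalNegation public

  record IsIntuitionisticNegation (n : Op₁ Carrier) : Set (c ⊔ ℓ₁ ⊔ ℓ₂) where
    field
      isMinimalNegation : IsMinimalNegation n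
      explosion         : ∀ x y → x ∧ n x ≤ y

    open IsMinimalNegation isMinimalNegation public

-- The signature of K_im-algebras over bounded distributive lattices; the
-- axioms on the two unary operations are in IsKim and IsKim∨ below.

record BinegationAlgebra c ℓ₁ ℓ₂ : Set (lsuc (c ⊔ ℓ₁ ⊔ ℓ₂)) where
  infix 8 ¬_ ∼_
  field
    lattice : BoundedDistributiveLattice c ℓ₁ ℓ₂

  open BoundedDistributiveLattice lattice public

  field
    ¬_ : Op₁ Carrier
    ∼_ : Op₁ Carrier

module _ (A : BinegationAlgebra c ℓ₁ ℓ₂) where
  open BinegationAlgebra A

  record IsKim : Set (c ⊔ ℓ₁ ⊔ ℓ₂) where
    field
      ¬-isIntuitionisticNegation : IsIntuitionisticNegation lattice ¬_
      ∼-isMinimalNegation        : IsMinimalNegation lattice ∼_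
      ¬¬∼⊤≈∼⊤                    : ¬ (¬ (∼ ⊤)) ≈ ∼ ⊤

    module Neg = IsIntuitionisticNegation ¬-isIntuitionisticNegation
    module Min = IsMinimalNegation ∼-isMinimalNegation

  record IsKim∨ : Set (c ⊔ ℓ₁ ⊔ ℓ₂) where
    field
      isKim : IsKim
      lem   : ∀ x → x ∨ ∼ x ≈ ⊤

    open IsKim isKim public

record AlgebraEmbedding (A : BinegationAlgebra c ℓ₁ ℓ₂)
                        (B : BinegationAlgebra c′ ℓ₁′ ℓ₂′)
                        : Set (c ⊔ ℓ₂ ⊔ c′ ⊔ ℓ₁′ ⊔ ℓ₂′) where
  private
    module A = BinegationAlgebra A
    module B = BinegationAlgebra B
  field
    to         : A.Carrier → B.Carrier
    preserving : ∀ {x y} → x A.≤ y → to x B.≤ to y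
    reflecting : ∀ {x y} → to x B.≤ to y → x A.≤ y
    ⊤-homo     : to A.⊤ B.≈ B.⊤
    ⊥-homo     : to A.⊥ B.≈ B.⊥
    ∨-homo     : ∀ x y → to (x A.∨ y) B.≈ to x B.∨ to y
    ∧-homo     : ∀ x y → to (x A.∧ y) B.≈ to x B.∧ to y
    ¬-homo     : ∀ x → to (A.¬ x) B.≈ B.¬ to x
    ∼-homo     : ∀ x → to (A.∼ x) B.≈ B.∼ to x

------------------------------------------------------------------------
-- Frames

-- C respects the equality of the poset, by C-down.

record CompatibilityFrame c ℓ₁ ℓ₂ : Set (lsuc (c ⊔ ℓ₁ ⊔ ℓ₂)) where
  field
    poset : Poset c ℓ₁ ℓ₂

  open Poset poset public renaming (Carrier to W)

  field
    C      : Rel W ℓ₂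
    C-down : ∀ {x x′ y y′} → x′ ≤ x → y′ ≤ y → C x y → C x′ y′

module _ (F : CompatibilityFrame c ℓ₁ ℓ₂) where
  open CompatibilityFrame F

  record IsSubCompatibility : Set (c ⊔ ℓ₂) where
    field
      C-sym    : ∀ {x y} → C x y → C y x
      C-extend : ∀ {x y} → C x y → ∃[ z ] (x ≤ z × y ≤ z × C x z)
      C-dense  : ∀ x → (∀ y → x ≤ y → ∃[ z ] (y ≤ z × (∄[ z′ ] C z z′))) →
                 ∄[ z″ ] C x z″

  record IsSubCompatibilityIdentity : Set (c ⊔ ℓ₂) where
    field
      isSubCompatibility : IsSubCompatibility
      C⇒≥                : ∀ {x y} → C x y → y ≤ x

    open IsSubCompatibility isSubCompatibility public

record FrameEmbedding (F : CompatibilityFrame c ℓ₁ ℓ₂)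
                      (G : CompatibilityFrame c′ ℓ₁′ ℓ₂′)
                      : Set (c ⊔ ℓ₂ ⊔ c′ ⊔ ℓ₂′) where
  private
    module F = CompatibilityFrame F
    module G = CompatibilityFrame G
  field
    to  : F.W → G.W
    ≤-⇔ : ∀ x y → (x F.≤ y) ⇔ (to x G.≤ to y)
    C-⇔ : ∀ x y → F.C x y ⇔ G.C (to x) (to y)

------------------------------------------------------------------------
-- The complex algebra of a frame

module _ (F : CompatibilityFrame c ℓ₁ ℓ₂) where
  open CompatibilityFrame F

  record Upset : Set (lsuc (c ⊔ ℓ₂)) where
    constructor upset
    field
      pred   : Pred W (c ⊔ ℓ₂)
      closed : ∀ {x y} → x ≤ y → x ∈ pred → y ∈ pred

  open Upset

  Up : BinegationAlgebra (lsuc (c ⊔ ℓ₂)) (c ⊔ ℓ₂) (c ⊔ ℓ₂)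
  Up = record
    { lattice = record
      { Carrier = Upset
      ; _≈_     = λ P Q → pred P ≐ pred Q
      ; _≤_     = λ P Q → pred P ⊆ pred Q
      ; _∨_     = λ P Q → upset (pred P ∪ pred Q)
                    (λ x≤y → [ inj₁ ∘ closed P x≤y , inj₂ ∘ closed Q x≤y ])
      ; _∧_     = λ P Q → upset (pred P ∩ pred Q)
                    (λ x≤y (p , q) → closed P x≤y p , closed Q x≤y q)
      ; ⊤       = upset U _
      ; ⊥       = upset ∅ (λ _ ())
      ; isBoundedLattice = record
        { isLattice = record
          { isPartialOrder = On.isPartialOrder pred ⊆-isPartialOrder
          ; supremum       = λ _ _ → inj₁ , inj₂ , λ _ f g → [ f , g ]
          ; infimum        = λ _ _ → proj₁ , proj₂ , λ _ f g p → f p , g p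
          }
        ; maximum = λ _ _ → _
        ; minimum = λ _ ()
        }
      ; ∧-distribˡ-∨ = λ _ _ _ →
          (λ (p , qr) → [ (λ q → inj₁ (p , q)) , (λ r → inj₂ (p , r)) ] qr) ,
          [ (λ (p , q) → p , inj₁ q) , (λ (p , r) → p , inj₂ r) ]
      }
    ; ¬_ = λ P → upset (λ w → ∀ v → w ≤ v → v ∉ pred P)
                       (λ x≤y h v y≤v → h v (trans x≤y y≤v))
    ; ∼_ = λ P → upset (λ w → ∀ v → C w v → v ∉ pred P)
                       (λ x≤y h v yCv → h v (C-down x≤y refl yCv))
    }

------------------------------------------------------------------------
-- The canonical frame of an algebra

-- Prime filters are proper; upward closure makes them respect _≈_.

record PrimeFilter (L : BoundedDistributiveLattice c ℓ₁ ℓ₂)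
                   : Set (lsuc (c ⊔ ℓ₂) ⊔ ℓ₁) where
  open BoundedDistributiveLattice L
  field
    pred   : Pred Carrier (c ⊔ ℓ₂)
    ⊤∈     : ⊤ ∈ pred
    ∧∈     : ∀ {x y} → x ∈ pred → y ∈ pred → x ∧ y ∈ pred
    closed : ∀ {x y} → x ≤ y → x ∈ pred → y ∈ pred
    ⊥∉     : ⊥ ∉ pred
    prime  : ∀ {x y} → x ∨ y ∈ pred → x ∈ pred ⊎ y ∈ pred

-- Defined for every algebra of the signature: none of the axioms of
-- K_im-algebras is needed to obtain a compatibility frame.

canonicalFrame : BinegationAlgebra c ℓ₁ ℓ₂ →
                 CompatibilityFrame (lsuc (c ⊔ ℓ₂) ⊔ ℓ₁) (c ⊔ ℓ₂) (c ⊔ ℓ₂)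
canonicalFrame A = record
  { poset  = record
    { isPartialOrder =
        On.isPartialOrder (PrimeFilter.pred {L = lattice}) ⊆-isPartialOrder }
  ; C      = λ P Q → ∀ a → ∼ a ∈ PrimeFilter.pred P → a ∉ PrimeFilter.pred Q
  ; C-down = λ P′⊆P Q′⊆Q PCQ a ∼a∈P′ a∈Q′ → PCQ a (P′⊆P ∼a∈P′) (Q′⊆Q a∈Q′)
  }
  where open BinegationAlgebra A

{-# OPTIONS --safe #-}

-- Part 1 is Stone's representation x ↦ {P : x ∈ P}.  It rests on separating a
-- filter from an ideal by a prime filter: for reflection of the order, x from
-- y; for ¬, the filter generated by P and x from ⊥; for ∼, x from the ideal
-- {y : ∼ y ∈ P}.
--
-- Separation needs Zorn's lemma.  Excluded middle is assumed for all types, not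
-- only for propositions, so it acts as a choice operator.  Choosing a
-- proper extension of each non-maximal set gives an inflationary map, and the
-- tower of its iterates (closed under unions) is a chain whose union is maximal.
--
-- Part 2 sends x to {U : x ∈ U}; the upsets {z : x ≤ z} and {z : not x C z}
-- show that ≤ and C are reflected.

module Submission where

open import Axiom.ExcludedMiddle using (ExcludedMiddle)
open import Axiom.Extensionality.Propositional using (Extensionality)
open import Data.Bool.Base using (Bool; false; T)
open import Data.Bool.Properties using (T-≡; ⇔→≡)
open import Data.Product using (_×_; _,_; proj₁; proj₂; ∃; ∃-syntax)
open import Data.Sum as Sum using (_⊎_; inj₁; inj₂; [_,_])
open import Function.Base using (_∘_; id; case_of_)
open import Function.Bundles using (mk⇔)
open import Function.Construct.Composition using (_⇔-∘_)
open import Function.Construct.Symmetry using (⇔-sym)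
open import Level using (Level; _⊔_; Lift; lift; lower)
open import Relation.Binary.PropositionalEquality using (_≡_; subst; sym)
open import Relation.Nullary using (¬_; Dec; yes; no; contradiction; isYes)
open import Relation.Nullary.Decidable using (decidable-stable; fromWitness; toWitness)
open import Relation.Unary using (Pred)
open import Defs

private
  variable
    a ℓ c ℓ₁ ℓ₂ : Level

-- Subsets are Boolean-valued so that a family of subsets of X lives in the
-- universe of X, and so that extensionality makes inclusion antisymmetric.

Subset : Set a → Set a
Subset X = X → Bool

infix 4 _∈_ _⊆_

_∈_ : {X : Set a} → X → Subset X → Set
x ∈ S = T (S x)

_⊆_ : {X : Set a} → Subset X → Subset X → Set a
S ⊆ S′ = ∀ x → x ∈ S → x ∈ S′

⊆-trans : {X : Set a} {R S S′ : Subset X} → R ⊆ S → S ⊆ S′ → R ⊆ S′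
⊆-trans p q x = q x ∘ p x

-- Boolean comprehension and unions.

module _ (em : ∀ {a} → ExcludedMiddle a) where

  byContradiction : {P : Set a} → ¬ ¬ P → P
  byContradiction = decidable-stable em

  ⟦_⟧ : {X : Set a} → Pred X ℓ → Subset X
  ⟦ P ⟧ x = isYes (em {P = P x})

  ⋃ : {X : Set a} → Subset (Subset X) → Subset X
  ⋃ 𝓢 = ⟦ (λ x → ∃[ S ] (S ∈ 𝓢 × x ∈ S)) ⟧

  ∈⟦⟧⁺ : {X : Set a} (P : Pred X ℓ) {x : X} → P x → x ∈ ⟦ P ⟧
  ∈⟦⟧⁺ P = fromWitness {a? = em}

  ∈⟦⟧⁻ : {X : Set a} (P : Pred X ℓ) {x : X} → x ∈ ⟦ P ⟧ → P x
  ∈⟦⟧⁻ P = toWitness {a? = em}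

  ∈⋃⁻ : {X : Set a} {𝓢 : Subset (Subset X)} {x : X} → x ∈ ⋃ 𝓢 → ∃[ S ] (S ∈ 𝓢 × x ∈ S)
  ∈⋃⁻ {𝓢 = 𝓢} = ∈⟦⟧⁻ (λ x → ∃[ S ] (S ∈ 𝓢 × x ∈ S))

  ⊆⋃ : {X : Set a} {𝓢 : Subset (Subset X)} {S : Subset X} → S ∈ 𝓢 → S ⊆ ⋃ 𝓢
  ⊆⋃ {𝓢 = 𝓢} S∈𝓢 _ x∈S =
    ∈⟦⟧⁺ (λ x → ∃[ S ] (S ∈ 𝓢 × x ∈ S)) (_ , S∈𝓢 , x∈S)

  ⋃-least : {X : Set a} {𝓢 : Subset (Subset X)} {S′ : Subset X} →
            (∀ {S} → S ∈ 𝓢 → S ⊆ S′) → ⋃ 𝓢 ⊆ S′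
  ⋃-least below x x∈⋃ with ∈⋃⁻ x∈⋃
  ... | _ , S∈𝓢 , x∈S = below S∈𝓢 x x∈S

  infix 5 _∪｛_｝

  _∪｛_｝ : {X : Set a} → Subset X → X → Subset X
  S ∪｛ x ｝ = ⟦ (λ y → y ∈ S ⊎ y ≡ x) ⟧

  ∈∪｛｝⁺ : {X : Set a} (S : Subset X) {x y : X} → y ∈ S ⊎ y ≡ x → y ∈ S ∪｛ x ｝
  ∈∪｛｝⁺ S {x} = ∈⟦⟧⁺ (λ y → y ∈ S ⊎ y ≡ x)

  ∈∪｛｝⁻ : {X : Set a} (S : Subset X) {x y : X} → y ∈ S ∪｛ x ｝ → y ∈ S ⊎ y ≡ x
  ∈∪｛｝⁻ S {x} = ∈⟦⟧⁻ (λ y → y ∈ S ⊎ y ≡ x)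

  -- Chains, towers and Zorn's lemma.

  IsChain : {X : Set a} → Subset (Subset X) → Set a
  IsChain 𝓢 = ∀ {S S′} → S ∈ 𝓢 → S′ ∈ 𝓢 → S ⊆ S′ ⊎ S′ ⊆ S

  -- The union of the empty family starts the tower.
  data Tower {X : Set a} (f : Subset X → Subset X) : Subset X → Set a where
    step  : ∀ {S} → Tower f S → Tower f (f S)
    union : ∀ 𝓢 → (∀ {S} → S ∈ 𝓢 → Tower f S) → Tower f (⋃ 𝓢)

  module _ (ext : ∀ {a b} → Extensionality a b) where

    ⊆-antisym : {X : Set a} {S S′ : Subset X} → S ⊆ S′ → S′ ⊆ S → S ≡ S′
    ⊆-antisym S⊆S′ S′⊆S = ext λ x →
      ⇔→≡ (T-≡ ⇔-∘ (mk⇔ (S⊆S′ x) (S′⊆S x) ⇔-∘ ⇔-sym T-≡))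

    module _ {X : Set a} {f : Subset X → Subset X} (f-inflationary : ∀ S → S ⊆ f S) where

      private
        -- `f` is not assumed monotone, so the two inclusions are first turned into an equality.
        f-cong : ∀ {S S′} → S ⊆ S′ → S′ ⊆ S → f S ⊆ f S′
        f-cong S⊆S′ S′⊆S x = subst (λ R → x ∈ f R) (⊆-antisym S⊆S′ S′⊆S)

      -- The second alternative bounds `f S′`, not merely `S′`: this settles the `step` case of
      -- `no-gap` at once.
      Comparable : Pred (Subset X) a
      Comparable S = ∀ {S′} → Tower f S′ → S ⊆ S′ ⊎ f S′ ⊆ S

      -- Induction on `S′`: at a `step`, mutual inclusion makes the two sets equal; at a `union`,
      -- either some member contains `f S` or all lie inside `S`.
      no-gap : ∀ {S} → Comparable S → ∀ {S′} → Tower f S′ → S′ ⊆ S ⊎ f S ⊆ S′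
      no-gap cmp (step {S′} t) with cmp t | no-gap cmp t
      ... | inj₂ fS′⊆S | _           = inj₁ fS′⊆S
      ... | inj₁ S⊆S′  | inj₁ S′⊆S   = inj₂ (f-cong S⊆S′ S′⊆S)
      ... | inj₁ _     | inj₂ fS⊆S′  = inj₂ (⊆-trans fS⊆S′ (f-inflationary S′))
      no-gap {S} cmp (union 𝓢 t) with em {P = ∃[ S′ ] (S′ ∈ 𝓢 × f S ⊆ S′)}
      ... | yes (_ , S′∈𝓢 , fS⊆S′) = inj₂ (⊆-trans fS⊆S′ (⊆⋃ S′∈𝓢))
      ... | no none = inj₁ (⋃-least λ {S′} S′∈𝓢 →
              [ id , (λ fS⊆S′ → contradiction (S′ , S′∈𝓢 , fS⊆S′) none) ]
                (no-gap cmp (t S′∈𝓢)))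

      -- Induction on `S`; at a `step`, `no-gap` rules out an `S′` strictly between `S` and `f S`.
      comparable : ∀ {S} → Tower f S → Comparable S
      comparable (step {S} s) {S′} t with comparable s t | no-gap (comparable s) t
      ... | inj₂ fS′⊆S | _          = inj₂ (⊆-trans fS′⊆S (f-inflationary S))
      ... | inj₁ _     | inj₂ fS⊆S′ = inj₁ fS⊆S′
      ... | inj₁ S⊆S′  | inj₁ S′⊆S  = inj₂ (f-cong S′⊆S S⊆S′)
      comparable (union 𝓢 s) {S′} t with em {P = ∃[ S ] (S ∈ 𝓢 × f S′ ⊆ S)}
      ... | yes (_ , S∈𝓢 , fS′⊆S) = inj₂ (⊆-trans fS′⊆S (⊆⋃ S∈𝓢))
      ... | no none = inj₁ (⋃-least λ {S} S∈𝓢 →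
              [ id , (λ fS′⊆S → contradiction (S , S∈𝓢 , fS′⊆S) none) ]
                (comparable (s S∈𝓢) t))

      tower-chain : ∀ {S S′} → Tower f S → Tower f S′ → S ⊆ S′ ⊎ S′ ⊆ S
      tower-chain {S′ = S′} s t = Sum.map₂ (⊆-trans (f-inflationary S′)) (comparable s t)

      -- The union of the whole tower belongs to the tower; so does its image under `f`, which
      -- therefore lies inside that union.
      tower-fixpoint : ∃[ M ] (Tower f M × f M ⊆ M)
      tower-fixpoint = _ , top , ⊆⋃ (∈⟦⟧⁺ (Tower f) (step top))
        where
        top : Tower f (⋃ ⟦ Tower f ⟧)
        top = union _ (∈⟦⟧⁻ (Tower f))

    module _ {X : Set a} (𝓒 : Pred (Subset X) ℓ)
             (⋃-closed : ∀ 𝓢 → IsChain 𝓢 → (∀ {S} → S ∈ 𝓢 → 𝓒 S) → 𝓒 (⋃ 𝓢)) where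

      private
        ProperExtension : Subset X → Set (a ⊔ ℓ)
        ProperExtension S = ∃[ S′ ] (𝓒 S′ × S ⊆ S′ × ¬ (S′ ⊆ S))

        -- The decision is an argument so that abstracting `em` in later proofs makes `extend S`
        -- reduce.
        choose : ∀ S → Dec (ProperExtension S) → Subset X
        choose S (yes (S′ , _)) = S′
        choose S (no _)         = S

        extend : Subset X → Subset X
        extend S = choose S em

        extend-inflationary : ∀ S → S ⊆ extend S
        extend-inflationary S with em {P = ProperExtension S}
        ... | yes (_ , _ , S⊆S′ , _) = S⊆S′
        ... | no _                   = λ _ → id

        extend-closed : ∀ {S} → 𝓒 S → 𝓒 (extend S)
        extend-closed {S} cS with em {P = ProperExtension S}
        ... | yes (_ , cS′ , _) = cS′
        ... | no _              = cS

        fixed⇒maximal : ∀ {M} → extend M ⊆ M → ∀ {S} → 𝓒 S → M ⊆ S → S ⊆ M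
        fixed⇒maximal {M} fM⊆M {S} cS M⊆S with em {P = ProperExtension M}
        ... | yes (_ , _ , _ , S′⊈M) = contradiction fM⊆M S′⊈M
        ... | no none = byContradiction λ S⊈M → none (S , cS , M⊆S , S⊈M)

        tower⇒𝓒 : ∀ {S} → Tower extend S → 𝓒 S
        tower⇒𝓒 (step t)    = extend-closed (tower⇒𝓒 t)
        tower⇒𝓒 (union 𝓢 t) = ⋃-closed 𝓢
          (λ S∈𝓢 S′∈𝓢 → tower-chain extend-inflationary (t S∈𝓢) (t S′∈𝓢))
          (λ S∈𝓢 → tower⇒𝓒 (t S∈𝓢))

      -- The empty family is a chain, so `⋃-closed` also provides a first member of `𝓒`.
      zorn : ∃[ M ] (𝓒 M × (∀ {S} → 𝓒 S → M ⊆ S → S ⊆ M))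
      zorn with tower-fixpoint extend-inflationary
      ... | M , t , fM⊆M = M , tower⇒𝓒 t , fixed⇒maximal fM⊆M

-- Generated filters in a distributive lattice.

module _ (L : BoundedDistributiveLattice c ℓ₁ ℓ₂) where
  open BoundedDistributiveLattice L

  ∧-monoˡ-≤ : ∀ {x y z} → x ≤ y → x ∧ z ≤ y ∧ z
  ∧-monoˡ-≤ x≤y = ∧-greatest (trans (x∧y≤x _ _) x≤y) (x∧y≤y _ _)

  distributed-bound : ∀ {x y z w} → z ∧ x ≤ w → z ∧ y ≤ w → z ∧ (x ∨ y) ≤ w
  distributed-bound p q = trans (reflexive (∧-distribˡ-∨ _ _ _)) (∨-least p q)

  -- Zorn's lemma will vary `S` with `F` fixed. Maximising over generating sets instead of filters
  -- makes the filter laws hold by construction.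
  data Generated (F : Pred Carrier (c ⊔ ℓ₂)) (S : Subset Carrier) : Pred Carrier (c ⊔ ℓ₂) where
    base : ∀ {x} → F x → Generated F S x
    gen  : ∀ {x} → x ∈ S → Generated F S x
    top  : Generated F S ⊤
    meet : ∀ {x y} → Generated F S x → Generated F S y → Generated F S (x ∧ y)
    up   : ∀ {x y} → x ≤ y → Generated F S x → Generated F S y

  module _ {F : Pred Carrier (c ⊔ ℓ₂)} where

    generated-mono : ∀ {S S′} → S ⊆ S′ → ∀ {x} → Generated F S x → Generated F S′ x
    generated-mono S⊆S′ (base x∈F) = base x∈F
    generated-mono S⊆S′ (gen x∈S)  = gen (S⊆S′ _ x∈S)
    generated-mono S⊆S′ top        = top
    generated-mono S⊆S′ (meet g h) = meet (generated-mono S⊆S′ g) (generated-mono S⊆S′ h)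
    generated-mono S⊆S′ (up x≤y g) = up x≤y (generated-mono S⊆S′ g)

    module _ (em : ∀ {a} → ExcludedMiddle a) where

      -- All uses of `x` in a derivation collapse into one: at a `meet`, the two bounds `z` are
      -- replaced by their meet.
      generated-∪｛｝ : ∀ {S x y} → Generated F (_∪｛_｝ em S x) y →
                      ∃[ z ] (Generated F S z × z ∧ x ≤ y)
      generated-∪｛｝ (base y∈F) = _ , base y∈F , x∧y≤x _ _
      generated-∪｛｝ {S} {x} (gen y∈) with ∈∪｛｝⁻ em S y∈
      ... | inj₁ y∈S = _ , gen y∈S , x∧y≤x _ _
      ... | inj₂ y≡x = ⊤ , top , subst (⊤ ∧ x ≤_) (sym y≡x) (x∧y≤y _ _)
      generated-∪｛｝ top = _ , top , x∧y≤x _ _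
      generated-∪｛｝ (meet g h) with generated-∪｛｝ g | generated-∪｛｝ h
      ... | _ , u , p | _ , v , q = _ , meet u v ,
            ∧-greatest (trans (∧-monoˡ-≤ (x∧y≤x _ _)) p)
                       (trans (∧-monoˡ-≤ (x∧y≤y _ _)) q)
      generated-∪｛｝ (up y≤y′ g) with generated-∪｛｝ g
      ... | _ , u , p = _ , u , trans p y≤y′

      -- The first alternative covers the empty chain.
      generated-⋃ : ∀ {𝓢} → IsChain em 𝓢 → ∀ {x} → Generated F (⋃ em 𝓢) x →
                    (∀ {S} → Generated F S x) ⊎ ∃[ S ] (S ∈ 𝓢 × Generated F S x)
      generated-⋃ chain (base x∈F) = inj₁ (base x∈F)
      generated-⋃ chain (gen x∈⋃) with ∈⋃⁻ em x∈⋃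
      ... | S , S∈𝓢 , x∈S = inj₂ (S , S∈𝓢 , gen x∈S)
      generated-⋃ chain top = inj₁ top
      generated-⋃ chain (meet g h) with generated-⋃ chain g | generated-⋃ chain h
      ... | inj₁ u             | inj₁ v            = inj₁ (meet u v)
      ... | inj₁ u             | inj₂ (S , S∈ , v) = inj₂ (S , S∈ , meet u v)
      ... | inj₂ (S , S∈ , u)  | inj₁ v            = inj₂ (S , S∈ , meet u v)
      ... | inj₂ (S , S∈ , u)  | inj₂ (S′ , S′∈ , v) with chain S∈ S′∈
      ...   | inj₁ S⊆S′ = inj₂ (S′ , S′∈ , meet (generated-mono S⊆S′ u) v)
      ...   | inj₂ S′⊆S = inj₂ (S , S∈ , meet u (generated-mono S′⊆S v))
      generated-⋃ chain (up x≤y g) with generated-⋃ chain g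
      ... | inj₁ u            = inj₁ (up x≤y u)
      ... | inj₂ (S , S∈ , u) = inj₂ (S , S∈ , up x≤y u)

  -- The prime filter separation theorem.

  record IsFilterBase {ℓ} (F : Pred Carrier ℓ) : Set (c ⊔ ℓ₂ ⊔ ℓ) where
    field
      inhabited : ∃ F
      directed  : ∀ {x y} → F x → F y → ∃[ z ] (F z × z ≤ x × z ≤ y)

  record IsIdealBase {ℓ} (I : Pred Carrier ℓ) : Set (c ⊔ ℓ₂ ⊔ ℓ) where
    field
      ⊥∈ : I ⊥
      ∨∈ : ∀ {x y} → I x → I y → I (x ∨ y)

  module _ {F : Pred Carrier (c ⊔ ℓ₂)} (isFilterBase : IsFilterBase F) where
    open IsFilterBase isFilterBase

    generated-by-base : ∀ {S x} → (∀ {y} → ¬ (y ∈ S)) → Generated F S x → ∃[ z ] (F z × z ≤ x)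
    generated-by-base empty (base x∈F) = _ , x∈F , refl
    generated-by-base empty (gen x∈S)  = contradiction x∈S empty
    generated-by-base empty top        = proj₁ inhabited , proj₂ inhabited , maximum _
    generated-by-base empty (meet g h)
      with generated-by-base empty g | generated-by-base empty h
    ... | _ , u , p | _ , v , q with directed u v
    ...   | _ , w , r , s = _ , w , ∧-greatest (trans r p) (trans s q)
    generated-by-base empty (up x≤y g) with generated-by-base empty g
    ... | _ , u , p = _ , u , trans p x≤y

  module _ (em : ∀ {a} → ExcludedMiddle a) (ext : ∀ {a b} → Extensionality a b)
           {F : Pred Carrier (c ⊔ ℓ₂)} {I : Pred Carrier ℓ}
           (isFilterBase : IsFilterBase F) (isIdealBase : IsIdealBase I)
           (disjoint : ∀ {x y} → F x → I y → ¬ (x ≤ y)) where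
    open IsIdealBase isIdealBase

    private
      Avoids : Pred (Subset Carrier) (c ⊔ ℓ₂ ⊔ ℓ)
      Avoids S = ∀ {x} → Generated F S x → ¬ I x

      nothing : Subset Carrier
      nothing _ = false

      nothing-avoids : Avoids nothing
      nothing-avoids g x∈I with generated-by-base isFilterBase (λ ()) g
      ... | _ , z∈F , z≤x = disjoint z∈F x∈I z≤x

      avoids-⋃ : ∀ 𝓢 → IsChain em 𝓢 → (∀ {S} → S ∈ 𝓢 → Avoids S) → Avoids (⋃ em 𝓢)
      avoids-⋃ 𝓢 chain avoids g with generated-⋃ em chain g
      -- The chain may have no member, but this derivation works over every generating set, in
      -- particular the empty one.
      ... | inj₁ u             = nothing-avoids u
      ... | inj₂ (S , S∈ , u)  = avoids S∈ u

    -- Properness comes from `⊥` lying in `I`; maximality of `M` enters through primeness.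
    separation : ∃[ P ] ((∀ {x} → F x → PrimeFilter.pred {L = L} P x) ×
                         (∀ {x} → I x → ¬ PrimeFilter.pred P x))
    separation with zorn em ext Avoids avoids-⋃
    ... | M , avoids , maximal = record
            { pred   = P
            ; ⊤∈     = top
            ; ∧∈     = meet
            ; closed = up
            ; ⊥∉     = λ g → avoids g ⊥∈
            ; prime  = prime
            } , base , λ x∈I g → avoids g x∈I
      where
      P : Pred Carrier (c ⊔ ℓ₂)
      P = Generated F M

      -- Otherwise `M` with `x` adjoined would still avoid `I`, and maximality would put `x` into
      -- `M`.
      blocked : ∀ {x} → ¬ P x → ∃[ z ] ∃[ i ] (P z × I i × z ∧ x ≤ i)
      blocked {x} x∉P = byContradiction em λ none →
        x∉P (gen (maximal
          (λ g i∈I → case generated-∪｛｝ em g of λ (z , z∈P , z∧x≤i) →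
             none (z , _ , z∈P , i∈I , z∧x≤i))
          (λ _ → ∈∪｛｝⁺ em M ∘ inj₁)
          x (∈∪｛｝⁺ em M (inj₂ _≡_.refl))))

      prime : ∀ {x y} → P (x ∨ y) → P x ⊎ P y
      prime {x} {y} x∨y∈P with em {P = P x} | em {P = P y}
      ... | yes x∈P | _       = inj₁ x∈P
      ... | no _    | yes y∈P = inj₂ y∈P
      ... | no x∉P  | no y∉P with blocked x∉P | blocked y∉P
      ...   | z , i , z∈P , i∈I , z∧x≤i | w , j , w∈P , j∈I , w∧y≤j =
        -- By distributivity `(z ∧ w) ∧ (x ∨ y) ≤ i ∨ j`, so `i ∨ j` would lie in both `P` and `I`.
        contradiction (∨∈ i∈I j∈I) (avoids (up
          (distributed-bound
            (trans (∧-monoˡ-≤ (x∧y≤x z w)) (trans z∧x≤i (x≤x∨y i j)))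
            (trans (∧-monoˡ-≤ (x∧y≤y z w)) (trans w∧y≤j (y≤x∨y i j))))
          (meet (meet z∈P w∈P) x∨y∈P)))

-- The Stone embedding of an algebra.

module _ (em : ∀ {a} → ExcludedMiddle a) (ext : ∀ {a b} → Extensionality a b)
         {A : BinegationAlgebra c ℓ₁ ℓ₂} (isKim : IsKim A) where
  open BinegationAlgebra A renaming (¬_ to neg; ∼_ to ∼′_)
  open IsKim isKim
  module Filter = PrimeFilter {L = lattice}

  private
    principal : ∀ x → IsFilterBase lattice (λ y → Lift c (x ≤ y))
    principal x = record
      { inhabited = ⊤ , lift (maximum _)
      ; directed  = λ (lift p) (lift q) → x , lift refl , p , q
      }

  separate : ∀ {x y} → ¬ (x ≤ y) → ∃[ P ] (Filter.pred P x × ¬ Filter.pred P y)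
  separate {x} {y} x≰y with separation lattice em ext (principal x)
    (record { ⊥∈ = minimum y ; ∨∈ = ∨-least })
    (λ (lift x≤z) w≤y z≤w → x≰y (trans x≤z (trans z≤w w≤y)))
  ... | P , F⊆P , I∌P = P , F⊆P (lift refl) , I∌P refl

  -- `contrapose` gives `y ∧ neg ⊥ ≤ neg x`, and `neg ⊥` is `⊤`.
  pseudocomplement : ∀ {x y} → y ∧ x ≤ ⊥ → y ≤ neg x
  pseudocomplement y∧x≤⊥ = trans
    (∧-greatest refl (trans (maximum _) (reflexive (Eq.sym Neg.n⊥≈⊤))))
    (Neg.contrapose y∧x≤⊥)

  -- If `P` and `x` generated `⊥`, some `y` in `P` would have `y ∧ x ≤ ⊥`, and `pseudocomplement`
  -- would put `neg x` in `P`.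
  ¬-witness : ∀ {P x} → ¬ Filter.pred P (neg x) →
              ∃[ Q ] ((∀ {y} → Filter.pred P y → Filter.pred Q y) × Filter.pred Q x)
  ¬-witness {P} {x} ¬x∉P with separation lattice em ext
    {F = λ z → ∃[ y ] (Filter.pred P y × y ∧ x ≤ z)} {I = _≤ ⊥}
    (record
      { inhabited = _ , ⊤ , Filter.⊤∈ P , refl
      ; directed  = λ (y , y∈P , p) (z , z∈P , q) →
          _ , (y ∧ z , Filter.∧∈ P y∈P z∈P , refl) ,
          trans (∧-monoˡ-≤ lattice (x∧y≤x _ _)) p ,
          trans (∧-monoˡ-≤ lattice (x∧y≤y _ _)) q
      })
    (record { ⊥∈ = refl ; ∨∈ = ∨-least })
    (λ (y , y∈P , p) w≤⊥ z≤w →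
      ¬x∉P (Filter.closed P (pseudocomplement (trans p (trans z≤w w≤⊥))) y∈P))
  ... | Q , F⊆Q , _ =
    Q , (λ y∈P → F⊆Q (_ , y∈P , x∧y≤x _ _)) , F⊆Q (⊤ , Filter.⊤∈ P , x∧y≤y _ _)

  -- Missing the ideal is exactly the canonical relation from `P` to `Q`. If some element above `x`
  -- were in the ideal, antitonicity would put `∼′ x` in `P`.
  ∼-witness : ∀ {P x} → ¬ Filter.pred P (∼′ x) →
              ∃[ Q ] ((∀ y → Filter.pred P (∼′ y) → ¬ Filter.pred Q y) × Filter.pred Q x)
  ∼-witness {P} {x} ∼x∉P with separation lattice em ext
    {I = λ y → Filter.pred P (∼′ y)}
    (principal x)
    (record
      { ⊥∈ = Filter.closed P (reflexive (Eq.sym Min.n⊥≈⊤)) (Filter.⊤∈ P)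
      ; ∨∈ = λ p q → Filter.closed P (Min.∧-∨ _ _) (Filter.∧∈ P p q)
      })
    (λ (lift x≤z) ∼w∈P z≤w → ∼x∉P (Filter.closed P (Min.antitone (trans x≤z z≤w)) ∼w∈P))
  ... | Q , F⊆Q , I∌Q = Q , (λ _ → I∌Q) , F⊆Q (lift refl)

  algebraEmbedding : AlgebraEmbedding A (Up (canonicalFrame A))
  algebraEmbedding = record
    { to         = λ x → upset (λ P → Lift _ (Filter.pred P x))
                               (λ P⊆Q (lift x∈P) → lift (P⊆Q x∈P))
    ; preserving = λ x≤y {P} (lift x∈P) → lift (Filter.closed P x≤y x∈P)
    ; reflecting = λ sub → byContradiction em λ x≰y →
        let P , x∈P , y∉P = separate x≰y in y∉P (lower (sub {P} (lift x∈P)))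
    ; ⊤-homo     = _ , λ {P} _ → lift (Filter.⊤∈ P)
    ; ⊥-homo     = (λ {P} (lift ⊥∈P) → contradiction ⊥∈P (Filter.⊥∉ P)) , λ ()
    ; ∨-homo     = λ x y →
        (λ {P} (lift x∨y∈P) → Sum.map lift lift (Filter.prime P x∨y∈P)) ,
        (λ {P} → [ (λ (lift x∈P) → lift (Filter.closed P (x≤x∨y x y) x∈P))
                 , (λ (lift y∈P) → lift (Filter.closed P (y≤x∨y x y) y∈P)) ])
    ; ∧-homo     = λ x y →
        (λ {P} (lift x∧y∈P) → lift (Filter.closed P (x∧y≤x x y) x∧y∈P) ,
                              lift (Filter.closed P (x∧y≤y x y) x∧y∈P)) ,
        (λ {P} (lift x∈P , lift y∈P) → lift (Filter.∧∈ P x∈P y∈P))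
    ; ¬-homo     = λ x →
        (λ (lift ¬x∈P) Q P⊆Q (lift x∈Q) →
          Filter.⊥∉ Q (Filter.closed Q (Neg.explosion x ⊥)
            (Filter.∧∈ Q x∈Q (P⊆Q ¬x∈P)))) ,
        (λ {P} none → lift (byContradiction em λ ¬x∉P →
          let Q , P⊆Q , x∈Q = ¬-witness {P} ¬x∉P in none Q P⊆Q (lift x∈Q)))
    ; ∼-homo     = λ x →
        (λ (lift ∼x∈P) Q PCQ (lift x∈Q) → PCQ x ∼x∈P x∈Q) ,
        (λ {P} none → lift (byContradiction em λ ∼x∉P →
          let Q , PCQ , x∈Q = ∼-witness {P} ∼x∉P in none Q PCQ (lift x∈Q)))
    }

-- The embedding of a frame by its point filters.

module _ (em : ∀ {a} → ExcludedMiddle a) (F : CompatibilityFrame c ℓ₁ ℓ₂) where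
  open CompatibilityFrame F

  frameEmbedding : FrameEmbedding F (canonicalFrame (Up F))
  frameEmbedding = record
    { to  = λ x → record
      { pred   = λ U → Lift _ (Upset.pred U x)
      ; ⊤∈     = _
      ; ∧∈     = λ (lift p) (lift q) → lift (p , q)
      ; closed = λ U⊆V (lift p) → lift (U⊆V p)
      ; ⊥∉     = λ ()
      ; prime  = λ (lift p) → Sum.map lift lift p
      }
    ; ≤-⇔ = λ x y → mk⇔
        (λ x≤y {U} (lift x∈U) → lift (Upset.closed U x≤y x∈U))
        (λ sub → lower (lower (sub {above x} (lift (lift refl)))))
    ; C-⇔ = λ x y → mk⇔
        (λ xCy U (lift x∈∼U) (lift y∈U) → x∈∼U y xCy y∈U)
        -- If `C x y` failed, `y` would lie in `incompatible x` while `x` lies in its `∼`, against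
        -- the canonical relation.
        (λ sub → byContradiction em λ ¬xCy →
          sub (incompatible x) (lift λ v xCv ¬xCv → lower ¬xCv xCv) (lift (lift ¬xCy)))
    }
    where
    above : W → Upset F
    above x = upset (λ z → Lift c (x ≤ z)) (λ z≤z′ (lift x≤z) → lift (trans x≤z z≤z′))

    incompatible : W → Upset F
    incompatible x = upset (λ z → Lift c (¬ C x z))
      (λ z≤z′ (lift ¬xCz) → lift (¬xCz ∘ C-down refl z≤z′))

theorem7p8 : (∀ {a} → ExcludedMiddle a) →
    (∀ {a b} → Extensionality a b) →
    ∀ {c ℓ₁ ℓ₂} →
    ((A : BinegationAlgebra c ℓ₁ ℓ₂) →
    (IsKim A → AlgebraEmbedding A (Up (canonicalFrame A))) ×
    (IsKim∨ A → AlgebraEmbedding A (Up (canonicalFrame A)))) ×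
    ((F : CompatibilityFrame c ℓ₁ ℓ₂) →
    (IsSubCompatibility F → FrameEmbedding F (canonicalFrame (Up F))) ×
    (IsSubCompatibilityIdentity F → FrameEmbedding F (canonicalFrame (Up F))))
theorem7p8 em ext =
  (λ A → algebraEmbedding em ext , algebraEmbedding em ext ∘ IsKim∨.isKim) ,
  (λ F → (λ _ → frameEmbedding em F) , (λ _ → frameEmbedding em F))
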